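{- Let $n\ge 1$ rectangles $1,\dots,n$ with positive integer dimensions (rectangle $j$ having width $w_j$ and height $h_j$, rotatable by $90^\circ$) and a rectangular container with positive integer width $W$ and height $H$ be given arbitrarily. If it is possible to orthogonally place all the rectangles into the container without overlapping (at integral positions), i.e. if a feasible packing of the $n$ rectangles exists, then a feasible packing of the $n$ rectangles can be found through a sequence of corner occupying actions. That is, there exist a feasible packing and an order in which the $n$ rectangles are placed, one at a time, at their positions in that packing, such that each placement is a corner occupying action with respect to the rectangles already placed and the four borders of the container.
   Context: Setting. The container is $[0,W]\times[0,H]$ in the $xy$-plane, with $W,H$ positive integers. A placement of rectangle $i$ is a triple $(x_i,y_i,v_i)$, where $x_i,y_i\in\mathbb{N}=\{0,1,2,\dots\}$ are the coordinates of its bottom-left corner point and $v_i\in\{0,1\}$ is its orientation: if $v_i=0$ it occupies $[x_i,x_i+w_i]\times[y_i,y_i+h_i]$, and if $v_i=1$ it is rotated by $90^\circ$ and occupies $[x_i,x_i+h_i]\times[y_i,y_i+w_i]$. A packing of a set of rectangles assigns a placement to each of them (so all vertices are at integral points). Feasible packing. A packing is feasible (non-overlapping) if every rectangle is contained in the container and the overlapping area of any two rectangles is zero. Bottom-left stability. In a feasible packing (of all or of some of the rectangles), a rectangle is bottom-left stable if it can move (slide) neither downwards nor leftwards without overlapping the other rectangles of the packing or overstepping the borders of the container: there is no $d>0$ such that all translates of the rectangle downwards by $t\in(0,d]$ stay in the container and have zero overlapping area with every other rectangle of the packing, and likewise for leftward translates. Bottom-left corner and corner occupying action. Given some rectangles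 already placed in the container without overlapping, a bottom-left corner is an unoccupied area where a suitable rectangle has bottom-left stability. A corner occupying action places a new rectangle onto a bottom-left corner and makes it bottom-left stable; i.e. the new rectangle is placed so that the resulting packing of the already placed rectangles together with the new one is feasible and the new rectangle is bottom-left stable in it. -}

module Defs where

open import Level using (0ℓ)
open import Data.Bool.Base using (Bool; true; false)
open import Data.Nat.Base as ℕ using (ℕ)
open import Data.Integer.Base using (+_)
open import Data.Rational.Base
  using (ℚ; 0ℚ; _/_; _+_; _-_; _*_; _⊔_; _⊓_; _≤_; _<_)
open import Data.Fin.Base as Fin using (Fin)
open import Data.Fin.Permutation using (Permutation′; _⟨$⟩ʳ_; _⟨$⟩ˡ_)
open import Data.Product.Base using (_×_; ∃)
open import Relation.Nullary.Negation.Core using (¬_)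
open import Relation.Unary using (Pred; _∈_; _∉_; _∪_; ｛_｝)
open import Relation.Binary.PropositionalEquality.Core using (_≡_; _≢_)

fromℕ : ℕ → ℚ
fromℕ m = + m / 1

-- The region [left , right] × [bottom , top].  Coordinates are rational
-- because a rectangle being slid passes through non-integral positions.
record Box : Set where
  constructor box
  field
    left right bottom top : ℚ

open Box

_⊑_ : Box → Box → Set
A ⊑ B = left B ≤ left A × right A ≤ right B × bottom B ≤ bottom A × top A ≤ top B

-- The length of [a , b] ∩ [c , d].
overlapLength : (a b c d : ℚ) → ℚ
overlapLength a b c d = 0ℚ ⊔ ((b ⊓ d) - (a ⊔ c))

overlapArea : Box → Box → ℚ
overlapArea A B =
  overlapLength (left A) (right A) (left B) (right B)
    * overlapLength (bottom A) (top A) (bottom B) (top B)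

shiftDown : ℚ → Box → Box
shiftDown t (box l r b u) = box l r (b - t) (u - t)

shiftLeft : ℚ → Box → Box
shiftLeft t (box l r b u) = box (l - t) (r - t) b u

record Placement : Set where
  constructor place
  field
    x y     : ℕ
    rotated : Bool

-- Rectangle i has width w i and height h i; the container has width W and
-- height H.
module RectanglePacking {n : ℕ} (w h : Fin n → ℕ) (W H : ℕ) where

  container : Box
  container = box 0ℚ (fromℕ W) 0ℚ (fromℕ H)

  occupied : Fin n → Placement → Box
  occupied i (place x y false) =
    box (fromℕ x) (fromℕ (x ℕ.+ w i)) (fromℕ y) (fromℕ (y ℕ.+ h i))
  occupied i (place x y true) =
    box (fromℕ x) (fromℕ (x ℕ.+ h i)) (fromℕ y) (fromℕ (y ℕ.+ w i))

  -- A packing of a set S of rectangles is a packing p together with S; the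
  -- placements that p gives to rectangles outside S are ignored.
  Packing : Set
  Packing = Fin n → Placement

  region : Packing → Fin n → Box
  region p i = occupied i (p i)

  Feasible : Pred (Fin n) 0ℓ → Packing → Set
  Feasible S p =
    (∀ i → i ∈ S → region p i ⊑ container) ×
    (∀ i j → i ∈ S → j ∈ S → i ≢ j → overlapArea (region p i) (region p j) ≡ 0ℚ)

  CanSlide : (ℚ → Box → Box) → Pred (Fin n) 0ℓ → Packing → Fin n → Set
  CanSlide shift S p i =
    ∃ λ (d : ℚ) → 0ℚ < d ×
      (∀ (t : ℚ) → 0ℚ < t → t ≤ d →
        shift t (region p i) ⊑ container ×
        (∀ j → j ∈ S → j ≢ i →
          overlapArea (shift t (region p i)) (region p j) ≡ 0ℚ))

  BottomLeftStable : Pred (Fin n) 0ℓ → Packing → Fin n → Set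
  BottomLeftStable S p i = ¬ CanSlide shiftDown S p i × ¬ CanSlide shiftLeft S p i

  -- The rectangles in S are already placed, and i is placed next, at p i.
  CornerOccupying : Pred (Fin n) 0ℓ → Packing → Fin n → Set
  CornerOccupying S p i =
    Feasible S p × i ∉ S ×
    Feasible (S ∪ ｛ i ｝) p × BottomLeftStable (S ∪ ｛ i ｝) p i

  -- Rectangle σ ⟨$⟩ʳ k is the one placed at step k.
  PlacedBefore : Permutation′ n → Fin n → Pred (Fin n) 0ℓ
  PlacedBefore σ k i = (σ ⟨$⟩ˡ i) Fin.< k

  CornerOccupyingSequence : Packing → Permutation′ n → Set
  CornerOccupyingSequence p σ =
    ∀ k → CornerOccupying (PlacedBefore σ k) p (σ ⟨$⟩ʳ k)

{-# OPTIONS --safe #-}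

-- Sliding rectangles down or left by one unit decreases the sum of all
-- coordinates, so after finitely many slides no rectangle can move.  By
-- integrality a rectangle that cannot move by one unit cannot move at all.
--
-- Place the rectangles so that every later one lies to the right of or above
-- every earlier one.  A later rectangle then never blocks the slide of an
-- earlier one, so each rectangle is already stable when it is placed.  To find
-- the rectangle to place first, consider the rectangles A such that nothing
-- starting left of the right side of A lies below A (a lowest rectangle is one),
-- and take the one with the leftmost right side.  A rectangle neither right of
-- nor above this A would lie left of A, and the lowest such rectangle would
-- have the same property with a smaller right side.
module Submission where

open import Defs
open import Data.Nat.Base using (ℕ; _≤_; _<_)
open import Data.Fin.Base using (Fin)
open import Data.Fin.Permutation using (Permutation′)
open import Data.Product.Base using (_×_; ∃)
open import Relation.Unary using (U)

open import Data.Bool.Base using (Bool; true; false)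
open import Data.Fin.Base as Fin using (zero; suc; punchIn)
open import Data.Fin.Permutation
  using (_⟨$⟩ʳ_; _⟨$⟩ˡ_; insert; insert-punchIn; inverseˡ; inverseʳ)
import Data.Fin.Permutation as Perm
open import Data.Fin.Properties as Fin using (any?; all?; punchInᵢ≢i; punchIn-injective)
open import Data.Integer.Base using (+_)
import Data.Integer.Base as ℤ
import Data.Integer.Properties as ℤ
open import Data.Nat.Base using (zero; suc; pred; _+_; z≤n; s<s; s≤s⁻¹)
import Data.Nat.Coprimality as Coprimality
open import Data.Nat.Induction using (Acc; acc; <-wellFounded)
open import Data.Nat.Properties as ℕ using (_≤?_; _<?_)
open import Data.Product.Base using (_,_; proj₁; proj₂)
open import Data.Rational.Base as ℚ using (ℚ; mkℚ; 0ℚ; 1ℚ)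
import Data.Rational.Properties as ℚ
open import Data.Sum.Base using (_⊎_; inj₁; inj₂; [_,_]′; swap)
import Data.Sum.Base as Sum
open import Data.Vec.Functional using (updateAt)
open import Data.Vec.Functional.Properties using (updateAt-updates; updateAt-minimal)
open import Function.Base using (_∘_)
open import Relation.Binary.Definitions using (tri<; tri≈; tri>)
open import Relation.Binary.PropositionalEquality
  using (_≡_; _≢_; refl; sym; trans; cong; subst; subst₂)
open import Relation.Nullary using (¬_; Dec; yes; no; contradiction)
open import Relation.Nullary.Decidable using (_×-dec_; _⊎-dec_; _→-dec_; ¬?)
open import Relation.Unary using (Pred; Decidable; _∈_; _∪_; ｛_｝)
open import Level using (0ℓ)

-- Minimal elements of decidable predicates.

minimal : ∀ {n} {P : Pred (Fin n) 0ℓ} → Decidable P → (f : Fin n → ℕ) →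
  ∃ P → ∃ λ i → P i × (∀ j → P j → f i ≤ f j)
minimal {P = P} P? f (i , Pi) = descend i Pi (<-wellFounded (f i))
  where
  descend : ∀ i → P i → Acc _<_ (f i) → ∃ λ i → P i × (∀ j → P j → f i ≤ f j)
  descend i Pi (acc rec) with any? (λ j → P? j ×-dec f j <? f i)
  ... | yes (j , Pj , fj<fi) = descend j Pj (rec fj<fi)
  ... | no  ¬smaller = i , Pi , λ j Pj → ℕ.≮⇒≥ λ fj<fi → ¬smaller (j , Pj , fj<fi)

-- Rectangles with integral vertices

record Cell : Set where
  constructor cell
  field
    left right bottom top : ℕ

open Cell

Nonempty : Cell → Set
Nonempty A = left A < right A × bottom A < top A

-- This is the relation under which `A` never obstructs a move of `B` down or left: such a move only
-- lowers the right and top sides of `B`, so it preserves the relation.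
_past_ : Cell → Cell → Set
A past B = right B ≤ left A ⊎ top B ≤ bottom A

Disjoint : Cell → Cell → Set
Disjoint A B = A past B ⊎ B past A

_past?_ : ∀ A B → Dec (A past B)
A past? B = (right B ≤? left A) ⊎-dec (top B ≤? bottom A)

-- Choosing the rectangle to place first.

module _ {n} (c : Fin (suc n) → Cell) (nonempty : ∀ i → Nonempty (c i))
  (disjoint : ∀ i j → i ≢ j → Disjoint (c i) (c j)) where

  private
    NothingBelow : Pred (Fin (suc n)) 0ℓ
    NothingBelow i = ∀ j → left (c j) < right (c i) → bottom (c i) < top (c j)

    nothingBelow? : Decidable NothingBelow
    nothingBelow? i =
      all? λ j → (left (c j) <? right (c i)) →-dec (bottom (c i) <? top (c j))

    lowest : ∃ NothingBelow
    lowest with minimal {P = U} (λ _ → yes _) (bottom ∘ c) (zero , _)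
    ... | i , _ , i-lowest =
      i , λ j _ → ℕ.≤-<-trans (i-lowest j _) (proj₂ (nonempty j))

    -- As `j` is neither past `i` nor below it, `j` lies to the left of `i` and starts under its
    -- top. The witness is the lowest rectangle of this kind: a rectangle violating `NothingBelow`
    -- for it would be of the same kind and lower still.
    lower : ∀ i → NothingBelow i → ∀ j → j ≢ i → ¬ c j past c i →
      ∃ λ k → NothingBelow k × right (c k) < right (c i)
    lower i i-nb j j≢i ¬j-past-i = k , k-nb , ℕ.≤-<-trans rk≤li li<ri
      where
      li<ri = proj₁ (nonempty i)

      LeftOf : Pred (Fin (suc n)) 0ℓ
      LeftOf k = right (c k) ≤ left (c i) × bottom (c k) < top (c i)

      j-leftOf : LeftOf j
      j-leftOf with disjoint j i j≢i
      ... | inj₁ j-past-i = contradiction j-past-i ¬j-past-i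
      ... | inj₂ (inj₁ rj≤li) = rj≤li , ℕ.≰⇒> (¬j-past-i ∘ inj₂)
      -- Not being past `i`, `j` starts left of the right side of `i`, so `NothingBelow i` forbids
      -- it to lie below.
      ... | inj₂ (inj₂ tj≤bi) =
        contradiction tj≤bi (ℕ.<⇒≱ (i-nb j (ℕ.≰⇒> (¬j-past-i ∘ inj₁))))

      least = minimal (λ k → (right (c k) ≤? left (c i)) ×-dec (bottom (c k) <? top (c i)))
        (bottom ∘ c) (j , j-leftOf)
      k = proj₁ least
      rk≤li = proj₁ (proj₁ (proj₂ least))
      bk<ti = proj₂ (proj₁ (proj₂ least))

      k-nb : NothingBelow k
      k-nb m lm<rk = ℕ.≰⇒> λ tm≤bk →
        let bm<bk = ℕ.<-≤-trans (proj₂ (nonempty m)) tm≤bk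
            lm<li = ℕ.<-≤-trans lm<rk rk≤li
            bi<tm = i-nb m (ℕ.<-trans lm<li li<ri)
            m≢i : m ≢ i
            m≢i = λ { refl → ℕ.<-irrefl refl lm<li }
            -- Of the four relative positions of `m` and `i` only `m` on the left survives: `m`
            -- starts left of `i` and under its top, and `NothingBelow i` excludes `m` below `i`.
            rm≤li = [ [ (λ ri≤lm → contradiction (ℕ.<-trans lm<li li<ri) (ℕ.≤⇒≯ ri≤lm))
                      , (λ ti≤bm → contradiction (ℕ.<-trans bm<bk bk<ti) (ℕ.≤⇒≯ ti≤bm)) ]′
                    , [ (λ rm≤li → rm≤li)
                      , (λ tm≤bi → contradiction bi<tm (ℕ.≤⇒≯ tm≤bi)) ]′ ]′
                    (disjoint m i m≢i)
        in ℕ.<⇒≱ bm<bk (proj₂ (proj₂ least) m (rm≤li , ℕ.<-trans bm<bk bk<ti))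

  first : ∃ λ i → ∀ j → j ≢ i → c j past c i
  first with minimal nothingBelow? (right ∘ c) lowest
  ... | i , i-nb , i-leftmost = i , i-first
    where
    i-first : ∀ j → j ≢ i → c j past c i
    i-first j j≢i with c j past? c i
    ... | yes j-past-i = j-past-i
    ... | no ¬j-past-i with lower i i-nb j j≢i ¬j-past-i
    ...   | k , k-nb , rk<ri = contradiction (i-leftmost k k-nb) (ℕ.<⇒≱ rk<ri)

-- The placing order.

insert-zero-order : ∀ {n} (R : Fin (suc n) → Fin (suc n) → Set) i (σ : Permutation′ n) →
  (∀ j → j ≢ i → R j i) →
  (∀ k m → k Fin.< m → R (punchIn i (σ ⟨$⟩ʳ m)) (punchIn i (σ ⟨$⟩ʳ k))) →
  ∀ k m → k Fin.< m → R (insert zero i σ ⟨$⟩ʳ m) (insert zero i σ ⟨$⟩ʳ k)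
insert-zero-order R i σ R-i R-σ zero (suc m) _ =
  subst (λ j → R j i) (sym (insert-punchIn zero i σ m)) (R-i _ (punchInᵢ≢i i _))
insert-zero-order R i σ R-i R-σ (suc k) (suc m) (s<s k<m) =
  subst₂ R (sym (insert-punchIn zero i σ m)) (sym (insert-punchIn zero i σ k)) (R-σ k m k<m)

-- Recursion on the number of rectangles: the one given by `first` takes step zero, and `punchIn`
-- renumbers the others, which stay pairwise disjoint.
order : ∀ {n} (c : Fin n → Cell) → (∀ i → Nonempty (c i)) →
  (∀ i j → i ≢ j → Disjoint (c i) (c j)) →
  ∃ λ (σ : Permutation′ n) → ∀ k m → k Fin.< m → c (σ ⟨$⟩ʳ m) past c (σ ⟨$⟩ʳ k)
order {zero}  c nonempty disjoint = Perm.id , λ ()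
order {suc n} c nonempty disjoint
  with first c nonempty disjoint
... | i , i-first
  with order (c ∘ punchIn i) (nonempty ∘ punchIn i)
    (λ j k j≢k → disjoint _ _ (j≢k ∘ punchIn-injective i j k))
... | σ , σ-order =
  insert zero i σ , insert-zero-order (λ j k → c j past c k) i σ i-first σ-order

-- Overlaps of rational intervals

ℚ-≤⇒≯ : ∀ {p q} → p ℚ.≤ q → ¬ q ℚ.< p
ℚ-≤⇒≯ p≤q q<p = ℚ.<-irrefl refl (ℚ.≤-<-trans p≤q q<p)

-- The operation `_/_` normalises by a gcd, which is stuck on a variable numerator. The explicit
-- normal form lets comparisons reduce to integers.
fromℕ-mkℚ : ∀ m → fromℕ m ≡ mkℚ (+ m) 0 (Coprimality.sym (Coprimality.1-coprimeTo m))
fromℕ-mkℚ m = ℚ.normalize-coprime (Coprimality.sym (Coprimality.1-coprimeTo m))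

fromℕ-mono-≤ : ∀ {m n} → m ≤ n → fromℕ m ℚ.≤ fromℕ n
fromℕ-mono-≤ {m} {n} m≤n rewrite fromℕ-mkℚ m | fromℕ-mkℚ n =
  ℚ.*≤* (ℤ.*-monoʳ-≤-nonNeg (+ 1) (ℤ.+≤+ m≤n))

fromℕ-cancel-≤ : ∀ {m n} → fromℕ m ℚ.≤ fromℕ n → m ≤ n
fromℕ-cancel-≤ {m} {n} m≤n rewrite fromℕ-mkℚ m | fromℕ-mkℚ n =
  ℤ.drop‿+≤+ (ℤ.*-cancelʳ-≤-pos _ _ (+ 1) (ℚ.drop-*≤* m≤n))

fromℕ-cancel-< : ∀ {m n} → fromℕ m ℚ.< fromℕ n → m < n
fromℕ-cancel-< m<n = ℕ.≰⇒> λ n≤m → ℚ-≤⇒≯ (fromℕ-mono-≤ n≤m) m<n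

fromℕ-mono-< : ∀ {m n} → m < n → fromℕ m ℚ.< fromℕ n
fromℕ-mono-< m<n = ℚ.≰⇒> λ n≤m → ℕ.<⇒≱ m<n (fromℕ-cancel-≤ n≤m)

fromℕ-suc : ∀ m → fromℕ m ℚ.+ 1ℚ ≡ fromℕ (suc m)
fromℕ-suc m rewrite fromℕ-mkℚ m =
  cong (ℚ._/ 1) (trans (cong (ℤ._+ + 1) (ℤ.*-identityʳ (+ m))) (ℤ.+-comm (+ m) (+ 1)))

p-q+q≡p : ∀ p q → p ℚ.- q ℚ.+ q ≡ p
p-q+q≡p p q = trans (ℚ.+-assoc p (ℚ.- q) q)
  (trans (cong (p ℚ.+_) (ℚ.+-inverseˡ q)) (ℚ.+-identityʳ p))

p-q≤r⇒p≤r+q : ∀ p q {r} → p ℚ.- q ℚ.≤ r → p ℚ.≤ r ℚ.+ q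
p-q≤r⇒p≤r+q p q {r} p-q≤r =
  subst (ℚ._≤ r ℚ.+ q) (p-q+q≡p p q) (ℚ.+-monoˡ-≤ q p-q≤r)

p-q<p : ∀ p {q} → 0ℚ ℚ.< q → p ℚ.- q ℚ.< p
p-q<p p {q} 0<q = subst (p ℚ.- q ℚ.<_) (ℚ.+-identityʳ p) (ℚ.+-monoʳ-< p (ℚ.neg-antimono-< 0<q))

apart⇒overlapLength≡0 : ∀ a b c d → b ℚ.≤ c ⊎ d ℚ.≤ a → overlapLength a b c d ≡ 0ℚ
apart⇒overlapLength≡0 a b c d apart = trans (ℚ.⊔-comm 0ℚ (b ℚ.⊓ d ℚ.- (a ℚ.⊔ c)))
  (ℚ.p≤q⇒p⊔q≡q (subst (b ℚ.⊓ d ℚ.- (a ℚ.⊔ c) ℚ.≤_) (ℚ.+-inverseʳ (a ℚ.⊔ c))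
    (ℚ.+-monoˡ-≤ (ℚ.- (a ℚ.⊔ c)) (b⊓d≤a⊔c apart))))
  where
  b⊓d≤a⊔c : b ℚ.≤ c ⊎ d ℚ.≤ a → b ℚ.⊓ d ℚ.≤ a ℚ.⊔ c
  b⊓d≤a⊔c (inj₁ b≤c) = ℚ.≤-trans (ℚ.p⊓q≤p b d) (ℚ.≤-trans b≤c (ℚ.p≤q⊔p a c))
  b⊓d≤a⊔c (inj₂ d≤a) = ℚ.≤-trans (ℚ.p⊓q≤q b d) (ℚ.≤-trans d≤a (ℚ.p≤p⊔q a c))

-- Zero overlap means that the smaller right end is at most the larger left end. Both ends coming
-- from one interval would contradict `a < b` or `c < d`; the two mixed cases are the two ways of
-- being apart.
overlapLength≡0⇒apart : ∀ {a b c d} → a ℚ.< b → c ℚ.< d →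
  overlapLength a b c d ≡ 0ℚ → b ℚ.≤ c ⊎ d ℚ.≤ a
overlapLength≡0⇒apart {a} {b} {c} {d} a<b c<d overlap≡0
  with ℚ.⊓-sel b d | ℚ.⊔-sel a c | b⊓d≤a⊔c
  where
  b⊓d≤a⊔c : b ℚ.⊓ d ℚ.≤ a ℚ.⊔ c
  b⊓d≤a⊔c = subst (b ℚ.⊓ d ℚ.≤_) (ℚ.+-identityˡ (a ℚ.⊔ c)) (p-q≤r⇒p≤r+q _ (a ℚ.⊔ c)
    (subst (b ℚ.⊓ d ℚ.- (a ℚ.⊔ c) ℚ.≤_) overlap≡0 (ℚ.p≤q⊔p 0ℚ (b ℚ.⊓ d ℚ.- (a ℚ.⊔ c)))))
... | inj₁ ≡b | inj₁ ≡a | ≤ = contradiction a<b (ℚ-≤⇒≯ (subst₂ ℚ._≤_ ≡b ≡a ≤))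
... | inj₁ ≡b | inj₂ ≡c | ≤ = inj₁ (subst₂ ℚ._≤_ ≡b ≡c ≤)
... | inj₂ ≡d | inj₁ ≡a | ≤ = inj₂ (subst₂ ℚ._≤_ ≡d ≡a ≤)
... | inj₂ ≡d | inj₂ ≡c | ≤ = contradiction c<d (ℚ-≤⇒≯ (subst₂ ℚ._≤_ ≡d ≡c ≤))

apart-fromℕ : ∀ a b c d → a < b → c < d →
  overlapLength (fromℕ a) (fromℕ b) (fromℕ c) (fromℕ d) ≡ 0ℚ → b ≤ c ⊎ d ≤ a
apart-fromℕ a b c d a<b c<d overlap≡0 = Sum.map fromℕ-cancel-≤ fromℕ-cancel-≤
  (overlapLength≡0⇒apart (fromℕ-mono-< a<b) (fromℕ-mono-< c<d) overlap≡0)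

-- Integrality turns a slide by some t ≤ 1 into a slide by a whole unit.
apart-shifted : ∀ a b c d t → 0ℚ ℚ.< t → t ℚ.≤ 1ℚ → a < b → c < d →
  overlapLength (fromℕ (suc a) ℚ.- t) (fromℕ (suc b) ℚ.- t) (fromℕ c) (fromℕ d) ≡ 0ℚ →
  b ≤ c ⊎ d ≤ a
apart-shifted a b c d t 0<t t≤1 a<b c<d overlap≡0 =
  Sum.map
    (λ b+1-t≤c → s≤s⁻¹ (fromℕ-cancel-≤ (subst (fromℕ (suc b) ℚ.≤_) (fromℕ-suc c)
      (ℚ.≤-trans (p-q≤r⇒p≤r+q _ t b+1-t≤c) (ℚ.+-monoʳ-≤ (fromℕ c) t≤1)))))
    (λ d≤a+1-t → s≤s⁻¹ (fromℕ-cancel-< (ℚ.≤-<-trans d≤a+1-t (p-q<p (fromℕ (suc a)) 0<t))))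
    (overlapLength≡0⇒apart (ℚ.+-monoˡ-< (ℚ.- t) (fromℕ-mono-< (s<s a<b)))
      (fromℕ-mono-< c<d) overlap≡0)

p*q≡0⇒p≡0∨q≡0 : ∀ p q → p ℚ.* q ≡ 0ℚ → p ≡ 0ℚ ⊎ q ≡ 0ℚ
p*q≡0⇒p≡0∨q≡0 p q pq≡0 with p ℚ.≟ 0ℚ
... | yes p≡0 = inj₁ p≡0
... | no  p≢0 = inj₂ (trans (sym (ℚ.*-identityˡ q)) (trans
    (cong (ℚ._* q) (sym (ℚ.*-inverseˡ p)))
    (trans (ℚ.*-assoc (ℚ.1/ p) p q) (trans (cong (ℚ.1/ p ℚ.*_) pq≡0) (ℚ.*-zeroʳ (ℚ.1/ p))))))
  where instance _ = ℚ.≢-nonZero p≢0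

-- Zero overlapping area and disjointness of integral rectangles.

overlapX overlapY : Box → Box → ℚ
overlapX A B = overlapLength (Box.left A) (Box.right A) (Box.left B) (Box.right B)
overlapY A B = overlapLength (Box.bottom A) (Box.top A) (Box.bottom B) (Box.top B)

overlapArea≡0⇒overlapX≡0∨overlapY≡0 : ∀ A B →
  overlapArea A B ≡ 0ℚ → overlapX A B ≡ 0ℚ ⊎ overlapY A B ≡ 0ℚ
overlapArea≡0⇒overlapX≡0∨overlapY≡0 A B = p*q≡0⇒p≡0∨q≡0 (overlapX A B) (overlapY A B)

overlapX≡0∨overlapY≡0⇒overlapArea≡0 : ∀ A B →
  overlapX A B ≡ 0ℚ ⊎ overlapY A B ≡ 0ℚ → overlapArea A B ≡ 0ℚ
overlapX≡0∨overlapY≡0⇒overlapArea≡0 A B (inj₁ x≡0) =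
  trans (cong (ℚ._* overlapY A B) x≡0) (ℚ.*-zeroˡ (overlapY A B))
overlapX≡0∨overlapY≡0⇒overlapArea≡0 A B (inj₂ y≡0) =
  trans (cong (overlapX A B ℚ.*_) y≡0) (ℚ.*-zeroʳ (overlapX A B))

toBox : Cell → Box
toBox (cell l r b t) = box (fromℕ l) (fromℕ r) (fromℕ b) (fromℕ t)

ApartX ApartY : Cell → Cell → Set
ApartX A B = right A ≤ left B ⊎ right B ≤ left A
ApartY A B = top A ≤ bottom B ⊎ top B ≤ bottom A

apart⇒disjoint : ∀ A B → ApartX A B ⊎ ApartY A B → Disjoint A B
apart⇒disjoint A B =
  [ [ inj₂ ∘ inj₁ , inj₁ ∘ inj₁ ]′ , [ inj₂ ∘ inj₂ , inj₁ ∘ inj₂ ]′ ]′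

disjoint⇒apart : ∀ A B → Disjoint A B → ApartX A B ⊎ ApartY A B
disjoint⇒apart A B =
  [ Sum.map inj₂ inj₂ , Sum.map inj₁ inj₁ ]′

overlapArea≡0⇒disjoint : ∀ A B → Nonempty A → Nonempty B →
  overlapArea (toBox A) (toBox B) ≡ 0ℚ → Disjoint A B
overlapArea≡0⇒disjoint A B (lA<rA , bA<tA) (lB<rB , bB<tB) area≡0 =
  apart⇒disjoint A B (Sum.map
    (apart-fromℕ (left A) (right A) (left B) (right B) lA<rA lB<rB)
    (apart-fromℕ (bottom A) (top A) (bottom B) (top B) bA<tA bB<tB)
    (overlapArea≡0⇒overlapX≡0∨overlapY≡0 (toBox A) (toBox B) area≡0))

disjoint⇒overlapArea≡0 : ∀ A B → Disjoint A B → overlapArea (toBox A) (toBox B) ≡ 0ℚ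
disjoint⇒overlapArea≡0 A B disjoint =
  overlapX≡0∨overlapY≡0⇒overlapArea≡0 (toBox A) (toBox B) (Sum.map
    (apart⇒overlapLength≡0 (fromℕ (left A)) (fromℕ (right A)) (fromℕ (left B)) (fromℕ (right B))
      ∘ Sum.map fromℕ-mono-≤ fromℕ-mono-≤)
    (apart⇒overlapLength≡0 (fromℕ (bottom A)) (fromℕ (top A)) (fromℕ (bottom B)) (fromℕ (top B))
      ∘ Sum.map fromℕ-mono-≤ fromℕ-mono-≤)
    (disjoint⇒apart A B disjoint))

-- Sliding

position : Placement → ℕ
position (place x y _) = x + y

-- Since `pred` fixes zero, a rectangle on the border stays where it is; `UnitSlide` therefore asks
-- for a strict decrease of `position`.
moveDown moveLeft : Placement → Placement
moveDown (place x y v) = place x (pred y) v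
moveLeft (place x y v) = place (pred x) y v

totalPosition : ∀ {n} → (Fin n → Placement) → ℕ
totalPosition {zero}  p = 0
totalPosition {suc n} p = position (p zero) + totalPosition (p ∘ suc)

totalPosition-updateAt : ∀ {n} (p : Fin n → Placement) i (f : Placement → Placement) →
  position (f (p i)) < position (p i) → totalPosition (updateAt p i f) < totalPosition p
totalPosition-updateAt p zero    f lt = ℕ.+-monoˡ-< _ lt
totalPosition-updateAt p (suc i) f lt =
  ℕ.+-monoʳ-< (position (p zero)) (totalPosition-updateAt (p ∘ suc) i f lt)

0<n⇒pred[n]<n : ∀ {n} → 0 < n → pred n < n
0<n⇒pred[n]<n {suc n} _ = ℕ.n<1+n n

0<t⇒0≤x-t⇒0<x : ∀ x {t} → 0ℚ ℚ.< t → 0ℚ ℚ.≤ fromℕ x ℚ.- t → 0 < x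
0<t⇒0≤x-t⇒0<x x 0<t 0≤x-t =
  fromℕ-cancel-< {0} {x} (ℚ.≤-<-trans 0≤x-t (p-q<p (fromℕ x) 0<t))

-- Integral form of feasibility.

module _ {n} (w h : Fin n → ℕ) (w>0 : ∀ j → 0 < w j) (h>0 : ∀ j → 0 < h j) (W H : ℕ) where

  open RectanglePacking w h W H

  width height : Fin n → Bool → ℕ
  width  i false = w i
  width  i true  = h i
  height i false = h i
  height i true  = w i

  -- The orientation is handed to `width` and `height`, so the corner coordinates compute without a
  -- case split on it.
  cellAt : Fin n → Placement → Cell
  cellAt i (place x y v) = cell x (x + width i v) y (y + height i v)

  occupied≡toBox : ∀ i P → occupied i P ≡ toBox (cellAt i P)
  occupied≡toBox i (place x y false) = refl
  occupied≡toBox i (place x y true)  = refl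

  width>0 : ∀ i v → 0 < width i v
  width>0 i false = w>0 i
  width>0 i true  = h>0 i

  height>0 : ∀ i v → 0 < height i v
  height>0 i false = h>0 i
  height>0 i true  = w>0 i

  nonempty : ∀ i P → Nonempty (cellAt i P)
  nonempty i (place x y v) =
    ℕ.m<m+n x (width>0 i v) , ℕ.m<m+n y (height>0 i v)

  Fits : Cell → Set
  Fits A = right A ≤ W × top A ≤ H

  ⊑⇒fits : ∀ A → toBox A ⊑ container → Fits A
  ⊑⇒fits A (_ , r≤W , _ , t≤H) =
    fromℕ-cancel-≤ {right A} {W} r≤W , fromℕ-cancel-≤ {top A} {H} t≤H

  fits⇒⊑ : ∀ A → Fits A → toBox A ⊑ container
  fits⇒⊑ A (r≤W , t≤H) =
    fromℕ-mono-≤ {0} {left A} z≤n , fromℕ-mono-≤ {right A} {W} r≤W ,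
    fromℕ-mono-≤ {0} {bottom A} z≤n , fromℕ-mono-≤ {top A} {H} t≤H

  Valid : Packing → Set
  Valid p = (∀ i → Fits (cellAt i (p i))) ×
    (∀ i j → i ≢ j → Disjoint (cellAt i (p i)) (cellAt j (p j)))

  feasible⇒valid : ∀ p → Feasible U p → Valid p
  feasible⇒valid p (contained , disjoint) =
    (λ i → ⊑⇒fits (cellAt i (p i)) (subst (_⊑ container) (occupied≡toBox i (p i)) (contained i _))) ,
    (λ i j i≢j → overlapArea≡0⇒disjoint (cellAt i (p i)) (cellAt j (p j))
      (nonempty i (p i)) (nonempty j (p j))
      (subst₂ (λ A B → overlapArea A B ≡ 0ℚ) (occupied≡toBox i (p i)) (occupied≡toBox j (p j))
        (disjoint i j _ _ i≢j)))

  -- Both conditions range over members of `S`, so validity of the whole packing passes to every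
  -- stage of the placing.
  valid⇒feasible : ∀ (S : Pred (Fin n) 0ℓ) p → Valid p → Feasible S p
  valid⇒feasible S p (fits , disjoint) =
    (λ i _ → subst (_⊑ container) (sym (occupied≡toBox i (p i)))
      (fits⇒⊑ (cellAt i (p i)) (fits i))) ,
    (λ i j _ _ i≢j → subst₂ (λ A B → overlapArea A B ≡ 0ℚ)
      (sym (occupied≡toBox i (p i))) (sym (occupied≡toBox j (p j)))
      (disjoint⇒overlapArea≡0 (cellAt i (p i)) (cellAt j (p j)) (disjoint i j i≢j)))

  -- Unit slides and settled packings.

  DisjointFromOthers : Packing → Fin n → Cell → Set
  DisjointFromOthers p i A = ∀ j → j ≢ i → Disjoint A (cellAt j (p j))

  -- Only the end position is tested: the descent in `settle` needs the new packing to be valid, not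
  -- the motion in between to be free.
  UnitSlide : (Placement → Placement) → Packing → Fin n → Set
  UnitSlide f p i = position (f (p i)) < position (p i) ×
    Fits (cellAt i (f (p i))) × DisjointFromOthers p i (cellAt i (f (p i)))

  unitSlide? : ∀ f p → Decidable (UnitSlide f p)
  unitSlide? f p i = (position (f (p i)) <? position (p i)) ×-dec
    ((right (cellAt i (f (p i))) ≤? W) ×-dec (top (cellAt i (f (p i))) ≤? H)) ×-dec
    all? λ j → ¬? (j Fin.≟ i) →-dec
      ((cellAt i (f (p i)) past? cellAt j (p j)) ⊎-dec (cellAt j (p j) past? cellAt i (f (p i))))

  valid-updateAt : ∀ {p} f i → Valid p → UnitSlide f p i → Valid (updateAt p i f)
  valid-updateAt {p} f i (fits , disjoint) (_ , fits-i , disjoint-i) = fits′ , disjoint′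
    where
    fits′ : ∀ j → Fits (cellAt j (updateAt p i f j))
    fits′ j with j Fin.≟ i
    ... | yes refl rewrite updateAt-updates i {f} p = fits-i
    ... | no  j≢i  rewrite updateAt-minimal j i {f} p j≢i = fits j

    disjoint′ : ∀ j k → j ≢ k →
      Disjoint (cellAt j (updateAt p i f j)) (cellAt k (updateAt p i f k))
    disjoint′ j k j≢k with j Fin.≟ i | k Fin.≟ i
    ... | yes refl | yes refl = contradiction refl j≢k
    ... | yes refl | no k≢i
      rewrite updateAt-updates i {f} p | updateAt-minimal k i {f} p k≢i = disjoint-i k k≢i
    ... | no j≢i | yes refl
      rewrite updateAt-updates i {f} p | updateAt-minimal j i {f} p j≢i = swap (disjoint-i j j≢i)
    ... | no j≢i | no k≢i
      rewrite updateAt-minimal j i {f} p j≢i | updateAt-minimal k i {f} p k≢i = disjoint j k j≢k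

  Settled : Packing → Set
  Settled p = ∀ i → ¬ UnitSlide moveDown p i × ¬ UnitSlide moveLeft p i

  settle : ∀ p → Valid p → ∃ λ q → Valid q × Settled q
  settle p valid = descend p valid (<-wellFounded (totalPosition p))
    where
    descend : ∀ p → Valid p → Acc _<_ (totalPosition p) → ∃ λ q → Valid q × Settled q
    descend p valid (acc rec)
      with any? (λ i → unitSlide? moveDown p i ⊎-dec unitSlide? moveLeft p i)
    ... | no ¬slide = p , valid , λ i →
      (λ slide → ¬slide (i , inj₁ slide)) , (λ slide → ¬slide (i , inj₂ slide))
    ... | yes (i , inj₁ slide) = descend _ (valid-updateAt moveDown i valid slide)
      (rec (totalPosition-updateAt p i moveDown (proj₁ slide)))
    ... | yes (i , inj₂ slide) = descend _ (valid-updateAt moveLeft i valid slide)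
      (rec (totalPosition-updateAt p i moveLeft (proj₁ slide)))

  -- From rational slides to unit slides.

  down-disjoint : ∀ i j P Q {t} → 0ℚ ℚ.< t → t ℚ.≤ 1ℚ → 0 < Placement.y P →
    overlapArea (shiftDown t (occupied i P)) (occupied j Q) ≡ 0ℚ →
    Disjoint (cellAt i (moveDown P)) (cellAt j Q)
  down-disjoint i j P@(place x (suc y) v) Q {t} 0<t t≤1 _ area≡0 =
    apart⇒disjoint A B (Sum.map
      (apart-fromℕ (left A) (right A) (left B) (right B)
        (proj₁ (nonempty i P)) (proj₁ (nonempty j Q)))
      -- Only the vertical extents move, so rounding up to a whole unit happens here alone. Matching
      -- the ordinate as `suc y` makes the cell of `P` the cell `A` raised by one, the form
      -- `apart-shifted` expects.
      (apart-shifted (bottom A) (top A) (bottom B) (top B) t 0<t t≤1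
        (proj₂ (nonempty i (moveDown P))) (proj₂ (nonempty j Q)))
      (overlapArea≡0⇒overlapX≡0∨overlapY≡0 (shiftDown t (toBox (cellAt i P))) (toBox B)
        (subst₂ (λ C D → overlapArea (shiftDown t C) D ≡ 0ℚ)
          (occupied≡toBox i P) (occupied≡toBox j Q) area≡0)))
    where
    A = cellAt i (moveDown P)
    B = cellAt j Q

  left-disjoint : ∀ i j P Q {t} → 0ℚ ℚ.< t → t ℚ.≤ 1ℚ → 0 < Placement.x P →
    overlapArea (shiftLeft t (occupied i P)) (occupied j Q) ≡ 0ℚ →
    Disjoint (cellAt i (moveLeft P)) (cellAt j Q)
  left-disjoint i j P@(place (suc x) y v) Q {t} 0<t t≤1 _ area≡0 =
    apart⇒disjoint A B (Sum.map
      (apart-shifted (left A) (right A) (left B) (right B) t 0<t t≤1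
        (proj₁ (nonempty i (moveLeft P))) (proj₁ (nonempty j Q)))
      (apart-fromℕ (bottom A) (top A) (bottom B) (top B)
        (proj₂ (nonempty i P)) (proj₂ (nonempty j Q)))
      (overlapArea≡0⇒overlapX≡0∨overlapY≡0 (shiftLeft t (toBox (cellAt i P))) (toBox B)
        (subst₂ (λ C D → overlapArea (shiftLeft t C) D ≡ 0ℚ)
          (occupied≡toBox i P) (occupied≡toBox j Q) area≡0)))
    where
    A = cellAt i (moveLeft P)
    B = cellAt j Q

  -- A single displacement of length at most one suffices for a unit slide. The container condition
  -- uses `toBox`, which exposes the coordinates whatever the orientation.
  ShortSlide : (ℚ → Box → Box) → Pred (Fin n) 0ℓ → Packing → Fin n → Set
  ShortSlide shift S p i = ∃ λ t → 0ℚ ℚ.< t × t ℚ.≤ 1ℚ ×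
    shift t (toBox (cellAt i (p i))) ⊑ container ×
    (∀ j → j ∈ S → j ≢ i → overlapArea (shift t (region p i)) (region p j) ≡ 0ℚ)

  canSlide⇒shortSlide : ∀ shift S p i → CanSlide shift S p i → ShortSlide shift S p i
  canSlide⇒shortSlide shift S p i (d , 0<d , slide) =
    t , 0<t , ℚ.p⊓q≤q d 1ℚ ,
    subst (λ A → shift t A ⊑ container) (occupied≡toBox i (p i)) (proj₁ slid) , proj₂ slid
    where
    t = d ℚ.⊓ 1ℚ
    0<t : 0ℚ ℚ.< t
    0<t = [ (λ t≡d → subst (0ℚ ℚ.<_) (sym t≡d) 0<d)
          , (λ t≡1 → subst (0ℚ ℚ.<_) (sym t≡1) (ℚ.positive⁻¹ 1ℚ)) ]′ (ℚ.⊓-sel d 1ℚ)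
    slid = slide t 0<t (ℚ.p⊓q≤p d 1ℚ)

  -- The rectangles outside S lie past rectangle i, where they cannot block its slide.
  module _ (S : Pred (Fin n) 0ℓ) (p : Packing) (i : Fin n) (fits : Fits (cellAt i (p i)))
    (inS∨past : ∀ j → j ≢ i → j ∈ S ⊎ cellAt j (p j) past cellAt i (p i)) where

    open Placement (p i) using (x; y)

    shortSlideDown⇒unitSlide : ShortSlide shiftDown S p i → UnitSlide moveDown p i
    shortSlideDown⇒unitSlide (t , 0<t , t≤1 , (_ , _ , 0≤y-t , _) , area≡0) =
      ℕ.+-monoʳ-< x (0<n⇒pred[n]<n y>0) ,
      (proj₁ fits , ℕ.≤-trans pred+m≤ (proj₂ fits)) ,
      λ j j≢i →
        [ (λ j∈S → down-disjoint i j (p i) (p j) 0<t t≤1 y>0 (area≡0 j j∈S j≢i))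
        -- Lowering `i` lowers its top and keeps its right side, so `j` stays past it.
        , inj₂ ∘ Sum.map₂ (ℕ.≤-trans pred+m≤) ]′ (inS∨past j j≢i)
      where
      y>0 = 0<t⇒0≤x-t⇒0<x y 0<t 0≤y-t
      pred+m≤ = ℕ.+-monoˡ-≤ _ (ℕ.pred[n]≤n {y})

    shortSlideLeft⇒unitSlide : ShortSlide shiftLeft S p i → UnitSlide moveLeft p i
    shortSlideLeft⇒unitSlide (t , 0<t , t≤1 , (0≤x-t , _) , area≡0) =
      ℕ.+-monoˡ-< y (0<n⇒pred[n]<n x>0) ,
      (ℕ.≤-trans pred+m≤ (proj₁ fits) , proj₂ fits) ,
      λ j j≢i →
        [ (λ j∈S → left-disjoint i j (p i) (p j) 0<t t≤1 x>0 (area≡0 j j∈S j≢i))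
        , inj₂ ∘ Sum.map₁ (ℕ.≤-trans pred+m≤) ]′ (inS∨past j j≢i)
      where
      x>0 = 0<t⇒0≤x-t⇒0<x x 0<t 0≤x-t
      pred+m≤ = ℕ.+-monoˡ-≤ _ (ℕ.pred[n]≤n {x})

  -- The corner occupying sequence of a settled packing.

  settled⇒cornerOccupyingSequence : ∀ p → Valid p → Settled p →
    ∃ λ (σ : Permutation′ n) → CornerOccupyingSequence p σ
  settled⇒cornerOccupyingSequence p valid settled = σ , λ k →
    valid⇒feasible (PlacedBefore σ k) p valid ,
    (λ k∈ → Fin.<-irrefl (inverseˡ σ) k∈) ,
    valid⇒feasible (PlacedBefore σ k ∪ ｛ σ ⟨$⟩ʳ k ｝) p valid ,
    stable (PlacedBefore σ k ∪ ｛ σ ⟨$⟩ʳ k ｝) (σ ⟨$⟩ʳ k) (placed k)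
    where
    c : Fin n → Cell
    c i = cellAt i (p i)

    ordered = order c (λ i → nonempty i (p i)) (proj₂ valid)
    σ = proj₁ ordered

    -- A slide that avoids only the rectangles in `S` already yields a unit slide in the whole
    -- packing, because all the others are past `i`; settledness excludes it.
    stable : ∀ S i → (∀ j → j ≢ i → j ∈ S ⊎ c j past c i) → BottomLeftStable S p i
    stable S i inS∨past =
      (λ canSlide → proj₁ (settled i) (shortSlideDown⇒unitSlide S p i (proj₁ valid i) inS∨past
        (canSlide⇒shortSlide shiftDown S p i canSlide))) ,
      (λ canSlide → proj₂ (settled i) (shortSlideLeft⇒unitSlide S p i (proj₁ valid i) inS∨past
        (canSlide⇒shortSlide shiftLeft S p i canSlide)))

    placed : ∀ k j → j ≢ σ ⟨$⟩ʳ k →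
      j ∈ PlacedBefore σ k ∪ ｛ σ ⟨$⟩ʳ k ｝ ⊎ c j past c (σ ⟨$⟩ʳ k)
    placed k j j≢σk with Fin.<-cmp (σ ⟨$⟩ˡ j) k
    ... | tri< before _ _ = inj₁ (inj₁ before)
    ... | tri≈ _ refl _ = contradiction (sym (inverseʳ σ)) j≢σk
    -- A rectangle not yet placed has a later step than `k`, so the placing order puts it past the
    -- current one.
    ... | tri> _ _ after = inj₂ (subst (λ i → c i past c (σ ⟨$⟩ʳ k)) (inverseʳ σ)
      (proj₂ ordered k (σ ⟨$⟩ˡ j) after))

  settled⇒cornerOccupyingPacking : (∃ λ q → Valid q × Settled q) →
    ∃ λ p → Feasible U p × (∃ λ (σ : Permutation′ n) → CornerOccupyingSequence p σ)
  settled⇒cornerOccupyingPacking (q , valid , settled) =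
    q , valid⇒feasible U q valid , settled⇒cornerOccupyingSequence q valid settled

theorem2 : (n : ℕ) → 1 ≤ n →
    (w h : Fin n → ℕ) → (∀ j → 0 < w j) → (∀ j → 0 < h j) →
    (W H : ℕ) → 0 < W → 0 < H →
    let open RectanglePacking w h W H in
    (∃ λ (p : Packing) → Feasible U p) →
    ∃ λ (p : Packing) → Feasible U p ×
    (∃ λ (σ : Permutation′ n) → CornerOccupyingSequence p σ)
theorem2 n _ w h w>0 h>0 W H _ _ (p , feasible) =
  settled⇒cornerOccupyingPacking w h w>0 h>0 W H
    (settle w h w>0 h>0 W H p (feasible⇒valid w h w>0 h>0 W H p feasible))
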